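{- Satisfiability is undecidable for the first-order unary conjunctive$^{\neq}$ view query language.
   Context: Fix a relational vocabulary $\sigma$ (finite set of relation symbols with arities). A unary conjunctive$^{\neq}$ view over $\sigma$ is a formula $V(y)\equiv\exists x_1,\ldots,x_n\,(\alpha_1\wedge\cdots\wedge\alpha_k)$ with exactly one free variable $y$, where each $\alpha_i$ is either a relational atom $R(u)$ with $R\in\sigma$ and $u$ a tuple of variables, or an inequality $z\neq z'$ between variables; it is written $V(y)\leftarrow\alpha_1,\ldots,\alpha_k$ (e.g. $V(x)\leftarrow R(x,y),S(x,x),x\neq y$). For a finite set $\mathcal{V}$ of such views, the first-order unary conjunctive$^{\neq}$ view language over $\mathcal{V}$ is the smallest set of formulas containing $V(x)$ for each $V\in\mathcal{V}$ and variable $x$, closed under $\neg$, $\wedge$ and $\exists x$, interpreted over $\sigma$-structures by expanding the view definitions. The satisfiability problem asks, given such a sentence and its view definitions, whether it has a model. -}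

module Defs where

open import Data.Nat using (ℕ; zero; suc; _+_; _<_)
open import Data.Fin using (Fin; toℕ)
open import Data.Vec using (Vec; []; _∷_; map; toList)
open import Data.Vec.Membership.Propositional using () renaming (_∈_ to _∈ᵥ_)
open import Data.List using (List)
import Data.List as L
open import Data.List.Relation.Unary.Any using (Any)
open import Data.List.Relation.Unary.All using (All)
open import Data.Product using (Σ; _×_; _,_)
open import Data.Sum using (_⊎_)
open import Data.Empty using (⊥)
open import Relation.Nullary using (¬_)
open import Relation.Binary.PropositionalEquality using (_≡_)

record Vocab : Set where
  field
    nrel  : ℕ
    arity : Fin nrel → ℕ

module _ (σ : Vocab) where
  open Vocab σ

  -- Atoms of a view body. Variables are natural numbers; variable 0 is
  -- the free variable y, all other variables are existentially quantified.
  data Atom : Set where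
    rel : (R : Fin nrel) → Vec ℕ (arity R) → Atom
    neq : ℕ → ℕ → Atom

  mentions : ℕ → Atom → Set
  mentions y (rel R us) = y ∈ᵥ us
  mentions y (neq a b)  = (y ≡ a) ⊎ (y ≡ b)

  record View : Set where
    field
      body       : List Atom
      freeOccurs : Any (mentions 0) body

  data Formula (k : ℕ) : ℕ → Set where
    view : ∀ {n} → Fin k → Fin n → Formula k n
    neg  : ∀ {n} → Formula k n → Formula k n
    and  : ∀ {n} → Formula k n → Formula k n → Formula k n
    ex   : ∀ {n} → Formula k (suc n) → Formula k n

  -- σ-structures (first-order semantics: nonempty domain)
  record Structure : Set₁ where
    field
      Carrier : Set
      elem    : Carrier
      relI    : (R : Fin nrel) → Vec Carrier (arity R) → Set

  module _ (M : Structure) where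
    open Structure M

    AtomHolds : (ℕ → Carrier) → Atom → Set
    AtomHolds ρ (rel R us) = relI R (map ρ us)
    AtomHolds ρ (neq a b)  = ¬ (ρ a ≡ ρ b)

    ViewHolds : View → Carrier → Set
    ViewHolds V a = Σ (ℕ → Carrier) λ ρ → (ρ 0 ≡ a) × All (AtomHolds ρ) (View.body V)

    extend : ∀ {n} → Carrier → (Fin n → Carrier) → Fin (suc n) → Carrier
    extend a ρ Fin.zero    = a
    extend a ρ (Fin.suc i) = ρ i

    Holds : ∀ {k n} → Vec View k → Formula k n → (Fin n → Carrier) → Set
    Holds 𝒱 (view V x) ρ = ViewHolds (Data.Vec.lookup 𝒱 V) (ρ x)
    Holds 𝒱 (neg φ)    ρ = ¬ Holds 𝒱 φ ρ
    Holds 𝒱 (and φ ψ)  ρ = Holds 𝒱 φ ρ × Holds 𝒱 ψ ρ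
    Holds 𝒱 (ex φ)     ρ = Σ Carrier λ a → Holds 𝒱 φ (extend a ρ)

  record Instance : Set where
    field
      k        : ℕ
      views    : Vec View k
      sentence : Formula k 0

  Satisfiable : Instance → Set₁
  Satisfiable I = Σ Structure λ M →
    Holds M (Instance.views I) (Instance.sentence I) (λ ())

-- Encoding of instances as natural numbers (Cantor pairing)

tri : ℕ → ℕ
tri zero    = zero
tri (suc n) = suc n + tri n

pair : ℕ → ℕ → ℕ
pair a b = tri (a + b) + b

codeList : List ℕ → ℕ
codeList L.[]       = 0
codeList (x L.∷ xs) = suc (pair x (codeList xs))

module _ (σ : Vocab) where
  codeAtom : Atom σ → ℕ
  codeAtom (rel R us) = pair 0 (pair (toℕ R) (codeList (toList us)))
  codeAtom (neq a b)  = pair 1 (pair a b)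

  codeView : View σ → ℕ
  codeView V = codeList (L.map codeAtom (View.body V))

  codeFormula : ∀ {k n} → Formula σ k n → ℕ
  codeFormula (view V x) = pair 0 (pair (toℕ V) (toℕ x))
  codeFormula (neg φ)    = pair 1 (codeFormula φ)
  codeFormula (and φ ψ)  = pair 2 (pair (codeFormula φ) (codeFormula ψ))
  codeFormula (ex φ)     = pair 3 (codeFormula φ)

  codeInstance : Instance σ → ℕ
  codeInstance I =
    pair (codeList (toList (map codeView (Instance.views I))))
         (codeFormula (Instance.sentence I))

data PR : ℕ → Set where
  Z    : ∀ {n} → PR n
  S    : PR 1
  P    : ∀ {n} → Fin n → PR n
  comp : ∀ {m n} → PR m → Vec (PR n) m → PR n
  prec : ∀ {n} → PR n → PR (suc (suc n)) → PR (suc n)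
  mu   : ∀ {n} → PR (suc n) → PR n

data Eval : ∀ {n} → PR n → Vec ℕ n → ℕ → Set
data EvalAll : ∀ {m n} → Vec (PR n) m → Vec ℕ n → Vec ℕ m → Set

data Eval where
  evZ    : ∀ {n} {xs : Vec ℕ n} → Eval Z xs 0
  evS    : ∀ {x} → Eval S (x ∷ []) (suc x)
  evP    : ∀ {n} {i : Fin n} {xs} → Eval (P i) xs (Data.Vec.lookup xs i)
  evComp : ∀ {m n} {f : PR m} {gs : Vec (PR n) m} {xs ys v} →
           EvalAll gs xs ys → Eval f ys v → Eval (comp f gs) xs v
  evRec0 : ∀ {n} {g : PR n} {h xs v} →
           Eval g xs v → Eval (prec g h) (0 ∷ xs) v
  evRecS : ∀ {n} {g : PR n} {h xs x r v} →
           Eval (prec g h) (x ∷ xs) r → Eval h (x ∷ r ∷ xs) v →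
           Eval (prec g h) (suc x ∷ xs) v
  evMu   : ∀ {n} {f : PR (suc n)} {xs z} →
           Eval f (z ∷ xs) 0 →
           (∀ y → y < z → Σ ℕ λ v → Eval f (y ∷ xs) (suc v)) →
           Eval (mu f) xs z

data EvalAll where
  []  : ∀ {n} {xs : Vec ℕ n} → EvalAll [] xs []
  _∷_ : ∀ {m n} {g : PR n} {gs : Vec (PR n) m} {xs y ys} →
        Eval g xs y → EvalAll gs xs ys → EvalAll (g ∷ gs) xs (y ∷ ys)

DecidesSat : (σ : Vocab) → PR 1 → Set₁
DecidesSat σ f = ∀ (I : Instance σ) →
  (Eval f (codeInstance σ I ∷ []) 1 × Satisfiable σ I)
  ⊎ (Eval f (codeInstance σ I ∷ []) 0 × ¬ Satisfiable σ I)

{-# OPTIONS --safe #-}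
module Submission where

-- Unary views with inequality express functional dependencies (a violation is a view that must
-- be empty) and implications between views sharing one variable.  If an element e witnessing
-- "the program c maps a to v" determines c, a and v, such implications can unfold one step of
-- the evaluation of c: whenever a model contains a witness for a terminating computation, it
-- contains witnesses for all the subcomputations, and the value v is the right one.  Hence
-- "p maps n to 0" has the term model if p n = 0 and no model if p n = 1.  A decision procedure
-- f is refuted by applying this to the p and n for which p n is f at the code of that sentence.
-- The implications hold in a model only up to double negation, so values are shown to be right
-- in the double negation monad.

open import Defs
open import Data.Nat using (ℕ; zero; suc; _+_; _<_; s≤s)
open import Data.Nat.Properties using (+-assoc; +-suc; +-identityʳ; m≤n+m)
open import Data.Fin using (Fin; zero; suc; toℕ; _↑ˡ_; _↑ʳ_)
open import Data.Fin.Patterns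
open import Data.Vec using (Vec; []; _∷_; map; toList; fromList; lookup; _++_)
open import Data.Vec.Properties using (map-∘; lookup-map; lookup-++ˡ; lookup-++ʳ)
open import Data.Vec.Relation.Unary.Any using (here)
open import Data.List as List using (List; []; _∷_; allFin; concatMap)
open import Data.List.Membership.Propositional using (_∈_)
open import Data.List.Membership.Propositional.Properties
  using (∈-++⁺ˡ; ∈-++⁺ʳ; ∈-map⁺; ∈-concatMap⁺; ∈-allFin; ∈-lookup)
open import Data.List.Relation.Unary.All as All using (All; []; _∷_)
open import Data.List.Relation.Unary.All.Properties using (++⁺; ++⁻ˡ; ++⁻ʳ; concat⁺; map⁺)
open import Data.List.Relation.Unary.Any as Any using (here; there)
open import Data.List.Relation.Unary.Any.Properties using (lookup-index)
open import Data.Product using (Σ; _×_; _,_; proj₁; proj₂)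
open import Data.Sum using (inj₁; inj₂)
open import Data.Empty using (⊥)
open import Data.Unit using (⊤; tt)
open import Function using (_∘_)
open import Relation.Nullary using (¬_)
open import Relation.Binary.PropositionalEquality
  using (_≡_; refl; sym; trans; cong; cong₂; subst)

-- Recursive functions for the coding

constP : ∀ {n} → ℕ → PR n
constP zero    = Z
constP (suc k) = comp S (constP k ∷ [])

constP-eval : ∀ {n} k {xs : Vec ℕ n} → Eval (constP k) xs k
constP-eval zero    = evZ
constP-eval (suc k) = evComp (constP-eval k ∷ []) evS

plusP : ∀ {n} → ℕ → PR n → PR n
plusP zero    p = p
plusP (suc k) p = comp S (plusP k p ∷ [])

plusP-eval : ∀ {n} k {p : PR n} {xs x} → Eval p xs x → Eval (plusP k p) xs (k + x)
plusP-eval zero    d = d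
plusP-eval (suc k) d = evComp (plusP-eval k d ∷ []) evS

addP : PR 2
addP = prec (P 0F) (comp S (P 1F ∷ []))

addP-eval : ∀ x y → Eval addP (x ∷ y ∷ []) (x + y)
addP-eval zero    y = evRec0 evP
addP-eval (suc x) y = evRecS (addP-eval x y) (evComp (evP ∷ []) evS)

triP : PR 1
triP = prec Z (comp addP (comp S (P 0F ∷ []) ∷ P 1F ∷ []))

triP-eval : ∀ x → Eval triP (x ∷ []) (tri x)
triP-eval zero    = evRec0 evZ
triP-eval (suc x) = evRecS (triP-eval x)
  (evComp (evComp (evP ∷ []) evS ∷ evP ∷ []) (addP-eval (suc x) (tri x)))

pairP : ∀ {n} → PR n → PR n → PR n
pairP p q = comp (comp addP (comp triP (addP ∷ []) ∷ P 1F ∷ [])) (p ∷ q ∷ [])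

pairP-eval : ∀ {n} {p q : PR n} {xs} x y → Eval p xs x → Eval q xs y →
  Eval (pairP p q) xs (pair x y)
pairP-eval x y d e = evComp (d ∷ e ∷ [])
  (evComp (evComp (addP-eval x y ∷ []) (triP-eval (x + y)) ∷ evP ∷ []) (addP-eval (tri (x + y)) y))

consP : ∀ {n} → PR n → PR n → PR n
consP p q = comp S (pairP p q ∷ [])

consP-eval : ∀ {n} {p q : PR n} {xs} y ys → Eval p xs y → Eval q xs (codeList ys) →
  Eval (consP p q) xs (codeList (y ∷ ys))
consP-eval y ys d e = evComp (pairP-eval y (codeList ys) d e ∷ []) evS

listP : ∀ {m n} → Vec (PR n) m → PR n
listP []       = Z
listP (p ∷ ps) = consP p (listP ps)

listP-eval : ∀ {m n} {ps : Vec (PR n) m} {xs ys} → EvalAll ps xs ys →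
  Eval (listP ps) xs (codeList (toList ys))
listP-eval []       = evZ
listP-eval (d ∷ ds) = consP-eval _ _ d (listP-eval ds)

relP : ∀ {m n} → ℕ → Vec (PR n) m → PR n
relP r ps = pairP Z (pairP (constP r) (listP ps))

-- Opaque, since the type checker must never evaluate the code of a concrete atom.
module _ (σ : Vocab) where
  opaque
    atomCode : Atom σ → ℕ
    atomCode = codeAtom σ

    atomsCode : List (Atom σ) → ℕ
    atomsCode as = codeList (List.map (codeAtom σ) as)

    atomsCode-body : ∀ V → atomsCode (View.body V) ≡ codeView σ V
    atomsCode-body V = refl

    relP-eval : ∀ {n} R us {ps : Vec (PR n) (Vocab.arity σ R)} {xs} → EvalAll ps xs us →
      Eval (relP (toℕ R) ps) xs (atomCode (rel R us))
    relP-eval R us ds =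
      pairP-eval 0 _ evZ (pairP-eval (toℕ R) _ (constP-eval (toℕ R)) (listP-eval ds))

    atomsP-eval-[] : ∀ {n} {xs : Vec ℕ n} → Eval Z xs (atomsCode [])
    atomsP-eval-[] = evZ

    atomsP-eval : ∀ {n} {p q : PR n} {xs} a as → Eval p xs (atomCode a) → Eval q xs (atomsCode as) →
      Eval (consP p q) xs (atomsCode (a ∷ as))
    atomsP-eval a as = consP-eval (codeAtom σ a) (List.map (codeAtom σ) as)

-- Diagonalisation

module _ {σ : Vocab} {k} (numeral : ℕ → View σ) (program : PR 1 → View σ)
         (rest : Vec (View σ) k) (φ : Formula σ (suc (suc k)) 0) where

  instanceOf : PR 1 → ℕ → Instance σ
  instanceOf p n = record { views = numeral n ∷ program p ∷ rest ; sentence = φ }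

  -- With p = f ∘ (n ↦ code of (n-th numeral, view coded by n)) and n the code of the
  -- program view of p, the instance of p and n says that f rejects that very instance.
  undecidable : (numeralP : PR 1) →
    (∀ n → Eval numeralP (n ∷ []) (codeView σ (numeral n))) →
    (∀ p n → Eval p (n ∷ []) 0 → Satisfiable σ (instanceOf p n)) →
    (∀ p n → Eval p (n ∷ []) 1 → ¬ Satisfiable σ (instanceOf p n)) →
    ¬ Σ (PR 1) (DecidesSat σ)
  undecidable numeralP numeralP-eval accept reject (f , decides) = absurd (decides I)
    where
    cs cφ : ℕ
    cs = codeList (toList (map (codeView σ) rest))
    cφ = codeFormula σ φ
    codeP p : PR 1
    codeP = pairP (comp S (pairP numeralP (comp S (pairP (P 0F) (constP cs) ∷ [])) ∷ []))
                  (constP cφ)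
    p = comp f (codeP ∷ [])
    n : ℕ
    n = codeView σ (program p)
    I : Instance σ
    I = instanceOf p n
    codeP-eval : Eval codeP (n ∷ []) (codeInstance σ I)
    codeP-eval = pairP-eval (suc (pair (codeView σ (numeral n)) (suc (pair n cs)))) cφ
      (evComp (pairP-eval (codeView σ (numeral n)) (suc (pair n cs)) (numeralP-eval n)
        (evComp (pairP-eval n cs evP (constP-eval cs) ∷ []) evS) ∷ []) evS)
      (constP-eval cφ)
    absurd : _ → ⊥
    absurd (inj₁ (d , sat))   = reject p n (evComp (codeP-eval ∷ []) d) sat
    absurd (inj₂ (d , unsat)) = unsat (accept p n (evComp (codeP-eval ∷ []) d))

-- Terms and their big-step semantics

-- Places after the first. Symbol 0 is the call relation, whose first place holds the witness;
-- symbol `suc k` stands for the graph of constructor `k`, whose first place holds the term built.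
ar : Fin 14 → ℕ
ar = lookup (3 ∷ 0 ∷ 1 ∷ 0 ∷ 2 ∷ 0 ∷ 0 ∷ 0 ∷ 1 ∷ 2 ∷ 2 ∷ 1 ∷ 1 ∷ 1 ∷ [])

pattern Zero = 0F
pattern Succ = 1F
pattern Nil  = 2F
pattern Cons = 3F
pattern Null = 4F
pattern Incr = 5F
pattern Head = 6F
pattern Skip = 7F
pattern Comp = 8F
pattern Prec = 9F
pattern Mu   = suc 9F
pattern Loop = suc (suc 9F)
pattern Test = suc (suc (suc 9F))

data Tree : Set where
  con : (k : Fin 13) → Vec Tree (ar (suc k)) → Tree

pattern zeroᵗ     = con Zero []
pattern sucᵗ t    = con Succ (t ∷ [])
pattern nilᵗ      = con Nil []
pattern consᵗ t u = con Cons (t ∷ u ∷ [])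
pattern nullᵗ     = con Null []
pattern incrᵗ     = con Incr []
pattern headᵗ     = con Head []
pattern skipᵗ c   = con Skip (c ∷ [])
pattern compᵗ f g = con Comp (f ∷ g ∷ [])
pattern precᵗ g h = con Prec (g ∷ h ∷ [])
pattern muᵗ f     = con Mu (f ∷ [])
pattern loopᵗ f   = con Loop (f ∷ [])
pattern testᵗ f   = con Test (f ∷ [])

infix 4 _·_⇓_

-- A list of programs is itself a program, computing the list of the results.  The program
-- mu f runs loop f from 0; loop f hands the value w of f at y, the head of its argument, to
-- test f, which returns y if w is zero and resumes loop f at y + 1 otherwise.
data _·_⇓_ : Tree → Tree → Tree → Set where
  null  : ∀ {a} → nullᵗ · a ⇓ zeroᵗ
  incr  : ∀ {x a} → incrᵗ · consᵗ x a ⇓ sucᵗ x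
  head  : ∀ {x a} → headᵗ · consᵗ x a ⇓ x
  skip  : ∀ {c x a v} → c · a ⇓ v → skipᵗ c · consᵗ x a ⇓ v
  comp  : ∀ {f gs a b v} → gs · a ⇓ b → f · b ⇓ v → compᵗ f gs · a ⇓ v
  nil   : ∀ {a} → nilᵗ · a ⇓ nilᵗ
  cons  : ∀ {g gs a v b} → g · a ⇓ v → gs · a ⇓ b → consᵗ g gs · a ⇓ consᵗ v b
  prec₀ : ∀ {g h a v} → g · a ⇓ v → precᵗ g h · consᵗ zeroᵗ a ⇓ v
  precₛ : ∀ {g h x a r v} → precᵗ g h · consᵗ x a ⇓ r → h · consᵗ x (consᵗ r a) ⇓ v →
          precᵗ g h · consᵗ (sucᵗ x) a ⇓ v
  mu    : ∀ {f a v} → loopᵗ f · consᵗ zeroᵗ a ⇓ v → muᵗ f · a ⇓ v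
  loop  : ∀ {f a w v} → f · a ⇓ w → testᵗ f · consᵗ w a ⇓ v → loopᵗ f · a ⇓ v
  test₀ : ∀ {f x a} → testᵗ f · consᵗ zeroᵗ (consᵗ x a) ⇓ x
  testₛ : ∀ {f w x a v} → loopᵗ f · consᵗ (sucᵗ x) a ⇓ v →
          testᵗ f · consᵗ (sucᵗ w) (consᵗ x a) ⇓ v

numᵗ : ℕ → Tree
numᵗ zero    = zeroᵗ
numᵗ (suc n) = sucᵗ (numᵗ n)

numsᵗ : ∀ {n} → Vec ℕ n → Tree
numsᵗ []       = nilᵗ
numsᵗ (x ∷ xs) = consᵗ (numᵗ x) (numsᵗ xs)

projᵗ : ∀ {n} → Fin n → Tree
projᵗ zero    = headᵗ
projᵗ (suc i) = skipᵗ (projᵗ i)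

progᵗ  : ∀ {n} → PR n → Tree
progsᵗ : ∀ {m n} → Vec (PR n) m → Tree
progᵗ Z           = nullᵗ
progᵗ S           = incrᵗ
progᵗ (P i)       = projᵗ i
progᵗ (comp f gs) = compᵗ (progᵗ f) (progsᵗ gs)
progᵗ (prec g h)  = precᵗ (progᵗ g) (progᵗ h)
progᵗ (mu f)      = muᵗ (progᵗ f)
progsᵗ []         = nilᵗ
progsᵗ (g ∷ gs)   = consᵗ (progᵗ g) (progsᵗ gs)

proj⇓ : ∀ {n} (i : Fin n) (xs : Vec ℕ n) → projᵗ i · numsᵗ xs ⇓ numᵗ (lookup xs i)
proj⇓ zero    (x ∷ xs) = head
proj⇓ (suc i) (x ∷ xs) = skip (proj⇓ i xs)

-- Induction on the number `k` of failing tests still to come, while the counter `y` climbs to `z`.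
loop⇓ : ∀ {f a z} → f · consᵗ (numᵗ z) a ⇓ zeroᵗ →
  (∀ y → y < z → Σ ℕ λ v → f · consᵗ (numᵗ y) a ⇓ numᵗ (suc v)) →
  ∀ k y → k + y ≡ z → loopᵗ f · consᵗ (numᵗ y) a ⇓ numᵗ z
loop⇓ d ds zero    y refl = loop d test₀
loop⇓ d ds (suc k) y refl =
  loop (proj₂ (ds y (s≤s (m≤n+m y k))))
       (testₛ (loop⇓ d ds k (suc y) (+-suc k y)))

-- Serves both halves of the reduction: a derivation with value 0 supplies the call in the term
-- model, and one with value 1 is followed through a hypothetical model.
Eval⇒⇓    : ∀ {n} {f : PR n} {xs v} → Eval f xs v → progᵗ f · numsᵗ xs ⇓ numᵗ v
EvalAll⇒⇓ : ∀ {m n} {gs : Vec (PR n) m} {xs ys} → EvalAll gs xs ys →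
            progsᵗ gs · numsᵗ xs ⇓ numsᵗ ys
Eval⇒⇓ evZ              = null
Eval⇒⇓ evS              = incr
Eval⇒⇓ (evP {i = i})    = proj⇓ i _
Eval⇒⇓ (evComp ds d)    = comp (EvalAll⇒⇓ ds) (Eval⇒⇓ d)
Eval⇒⇓ (evRec0 d)       = prec₀ (Eval⇒⇓ d)
Eval⇒⇓ (evRecS d e)     = precₛ (Eval⇒⇓ d) (Eval⇒⇓ e)
Eval⇒⇓ (evMu {z = z} d ds) =
  mu (loop⇓ (Eval⇒⇓ d) (λ y y<z → proj₁ (ds y y<z) , Eval⇒⇓ (proj₂ (ds y y<z)))
            z 0 (+-identityʳ z))
EvalAll⇒⇓ []       = nil
EvalAll⇒⇓ (d ∷ ds) = cons (Eval⇒⇓ d) (EvalAll⇒⇓ ds)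

-- The views and the sentence

σ : Vocab
σ = record { nrel = 14 ; arity = suc ∘ ar }

-- call e c a v: the element e witnesses that the program c maps the argument a to v.
call : ℕ → ℕ → ℕ → ℕ → Atom σ
call e c a v = rel zero (e ∷ c ∷ a ∷ v ∷ [])

infix 6 _≔_⟨_⟩

_≔_⟨_⟩ : ℕ → (k : Fin 13) → Vec ℕ (ar (suc k)) → Atom σ
x ≔ k ⟨ us ⟩ = rel (suc k) (x ∷ us)

viewAt : (R : Fin 14) → Vec ℕ (ar R) → List (Atom σ) → View σ
viewAt R us as = record { body = rel R (0 ∷ us) ∷ as ; freeOccurs = here (here refl) }

callView : List (Atom σ) → View σ
callView = viewAt zero (1 ∷ 2 ∷ 3 ∷ [])

data Rule : Set where
  null incr head skip comp nil cons prec₀ precₛ mu loop test₀ testₛ : Rule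

-- Only variable 0 is shared by the two views of a rule, but the functional dependencies make
-- it determine variables 1, 2, 3 and all the subterms of these.
premises conclusions : Rule → List (Atom σ)
premises null  = 1 ≔ Null ⟨ [] ⟩ ∷ []
premises incr  = 1 ≔ Incr ⟨ [] ⟩ ∷ []
premises head  = 1 ≔ Head ⟨ [] ⟩ ∷ []
premises skip  = 1 ≔ Skip ⟨ 4 ∷ [] ⟩ ∷ []
premises comp  = 1 ≔ Comp ⟨ 4 ∷ 5 ∷ [] ⟩ ∷ []
premises nil   = 1 ≔ Nil ⟨ [] ⟩ ∷ []
premises cons  = 1 ≔ Cons ⟨ 4 ∷ 5 ∷ [] ⟩ ∷ []
premises prec₀ = 1 ≔ Prec ⟨ 4 ∷ 5 ∷ [] ⟩ ∷ 2 ≔ Cons ⟨ 6 ∷ 7 ∷ [] ⟩ ∷ 6 ≔ Zero ⟨ [] ⟩ ∷ []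
premises precₛ = 1 ≔ Prec ⟨ 4 ∷ 5 ∷ [] ⟩ ∷ 2 ≔ Cons ⟨ 6 ∷ 7 ∷ [] ⟩ ∷ 6 ≔ Succ ⟨ 8 ∷ [] ⟩ ∷ []
premises mu    = 1 ≔ Mu ⟨ 4 ∷ [] ⟩ ∷ []
premises loop  = 1 ≔ Loop ⟨ 4 ∷ [] ⟩ ∷ []
premises test₀ = 1 ≔ Test ⟨ 4 ∷ [] ⟩ ∷ 2 ≔ Cons ⟨ 5 ∷ 6 ∷ [] ⟩ ∷ 5 ≔ Zero ⟨ [] ⟩ ∷ []
premises testₛ = 1 ≔ Test ⟨ 4 ∷ [] ⟩ ∷ 2 ≔ Cons ⟨ 5 ∷ 6 ∷ [] ⟩ ∷ 5 ≔ Succ ⟨ 7 ∷ [] ⟩ ∷ []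

conclusions null  = 3 ≔ Zero ⟨ [] ⟩ ∷ []
conclusions incr  = 2 ≔ Cons ⟨ 4 ∷ 5 ∷ [] ⟩ ∷ 3 ≔ Succ ⟨ 4 ∷ [] ⟩ ∷ []
conclusions head  = 2 ≔ Cons ⟨ 3 ∷ 4 ∷ [] ⟩ ∷ []
conclusions skip  = 1 ≔ Skip ⟨ 4 ∷ [] ⟩ ∷ 2 ≔ Cons ⟨ 5 ∷ 6 ∷ [] ⟩ ∷ call 7 4 6 3 ∷ []
conclusions comp  = 1 ≔ Comp ⟨ 4 ∷ 5 ∷ [] ⟩ ∷ call 6 5 2 7 ∷ call 8 4 7 3 ∷ []
conclusions nil   = 3 ≔ Nil ⟨ [] ⟩ ∷ []
conclusions cons  = 1 ≔ Cons ⟨ 4 ∷ 5 ∷ [] ⟩ ∷ 3 ≔ Cons ⟨ 6 ∷ 7 ∷ [] ⟩ ∷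
                    call 8 4 2 6 ∷ call 9 5 2 7 ∷ []
conclusions prec₀ = 1 ≔ Prec ⟨ 4 ∷ 5 ∷ [] ⟩ ∷ 2 ≔ Cons ⟨ 6 ∷ 7 ∷ [] ⟩ ∷ call 8 4 7 3 ∷ []
conclusions precₛ = 1 ≔ Prec ⟨ 4 ∷ 5 ∷ [] ⟩ ∷ 2 ≔ Cons ⟨ 6 ∷ 7 ∷ [] ⟩ ∷ 6 ≔ Succ ⟨ 8 ∷ [] ⟩ ∷
                    9 ≔ Cons ⟨ 8 ∷ 7 ∷ [] ⟩ ∷ call 10 1 9 11 ∷
                    12 ≔ Cons ⟨ 11 ∷ 7 ∷ [] ⟩ ∷ 13 ≔ Cons ⟨ 8 ∷ 12 ∷ [] ⟩ ∷ call 14 5 13 3 ∷ []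
conclusions mu    = 1 ≔ Mu ⟨ 4 ∷ [] ⟩ ∷ 5 ≔ Zero ⟨ [] ⟩ ∷ 6 ≔ Cons ⟨ 5 ∷ 2 ∷ [] ⟩ ∷
                    7 ≔ Loop ⟨ 4 ∷ [] ⟩ ∷ call 8 7 6 3 ∷ []
conclusions loop  = 1 ≔ Loop ⟨ 4 ∷ [] ⟩ ∷ call 5 4 2 6 ∷ 7 ≔ Cons ⟨ 6 ∷ 2 ∷ [] ⟩ ∷
                    8 ≔ Test ⟨ 4 ∷ [] ⟩ ∷ call 9 8 7 3 ∷ []
conclusions test₀ = 2 ≔ Cons ⟨ 4 ∷ 5 ∷ [] ⟩ ∷ 5 ≔ Cons ⟨ 3 ∷ 6 ∷ [] ⟩ ∷ []
conclusions testₛ = 1 ≔ Test ⟨ 4 ∷ [] ⟩ ∷ 2 ≔ Cons ⟨ 5 ∷ 6 ∷ [] ⟩ ∷ 6 ≔ Cons ⟨ 7 ∷ 8 ∷ [] ⟩ ∷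
                    9 ≔ Succ ⟨ 7 ∷ [] ⟩ ∷ 10 ≔ Cons ⟨ 9 ∷ 8 ∷ [] ⟩ ∷ 11 ≔ Loop ⟨ 4 ∷ [] ⟩ ∷
                    call 12 11 10 3 ∷ []

-- The inequality makes this view empty in every structure, so an implication towards it says that
-- its premise is empty.
falseView : View σ
falseView = callView (neq 0 0 ∷ [])

clashView : View σ
clashView = viewAt (suc Zero) [] (0 ≔ Succ ⟨ 1 ∷ [] ⟩ ∷ [])

-- Disjoint tuples of variables, interleaved so that a single recursion through two vectors of equal
-- length defines an assignment to both.
evens odds : ∀ n → Vec ℕ n
evens zero    = []
evens (suc n) = 0 ∷ map (2 +_) (evens n)
odds zero     = []
odds (suc n)  = 1 ∷ map (2 +_) (odds n)

-- The shift reserves variable 0 for the first place, which both atoms of `FDView` share.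
FDVars : (∀ n → Vec ℕ n) → (R : Fin 14) → Vec ℕ (ar R)
FDVars f R = map suc (f (ar R))

-- A body is a conjunction and cannot say that two tuples differ somewhere, so each position `i`
-- gets its own violation.
FDView : (R : Fin 14) → Fin (ar R) → View σ
FDView R i = viewAt R (FDVars evens R)
  (rel R (0 ∷ FDVars odds R) ∷ neq (lookup (FDVars evens R) i) (lookup (FDVars odds R) i) ∷ [])

allRules : List Rule
allRules = null ∷ incr ∷ head ∷ skip ∷ comp ∷ nil ∷ cons ∷ prec₀ ∷ precₛ ∷ mu ∷ loop ∷
           test₀ ∷ testₛ ∷ []

ruleImplication : Rule → View σ × View σ
ruleImplication r = callView (premises r) , callView (conclusions r)

FDImplications : (R : Fin 14) → List (View σ × View σ)
FDImplications R = List.map (λ i → FDView R i , falseView) (allFin (ar R))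

implications : List (View σ × View σ)
implications = (clashView , falseView) ∷
  (List.map ruleImplication allRules List.++ concatMap FDImplications (allFin 14))

ruleViews : (L : List (View σ × View σ)) → Vec (View σ) (List.length L + List.length L)
ruleViews L = map proj₁ (fromList L) ++ map proj₂ (fromList L)

-- The universal implication in the available connectives; its outer negation is the source of the
-- double negation in `Obeys`.
implies : ∀ {m} → Fin m → Fin m → Formula σ m 0
implies i j = neg (ex (and (view i 0F) (neg (view j 0F))))

conj : ∀ {m n} → Formula σ m 0 → (Fin n → Formula σ m 0) → Formula σ m 0
conj {n = zero}  φ ψ = φ
conj {n = suc n} φ ψ = and (ψ zero) (conj φ (ψ ∘ suc))

-- Views 0 and 1 are the numeral and the program. Holding at one element, they speak of the same
-- call: the former fixes its argument and value, the latter its program.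
start : ∀ {m} → Formula σ (suc (suc m)) 0
start = ex (and (view 0F 0F) (view 1F 0F))

obeysRule : ∀ n → Fin n → Formula σ (suc (suc (n + n))) 0
obeysRule n i = implies (suc (suc (i ↑ˡ n))) (suc (suc (n ↑ʳ i)))

sentenceFor : (L : List (View σ × View σ)) →
  Formula σ (suc (suc (List.length L + List.length L))) 0
sentenceFor L = conj start (obeysRule (List.length L))

-- Views for a program and for a numeral

size  : Tree → ℕ
sizes : ∀ {n} → Vec Tree n → ℕ
size (con k ts) = suc (sizes ts)
sizes []        = 0
sizes (t ∷ ts)  = size t + sizes ts

-- A tree becomes a conjunction of atoms with its subterms numbered in preorder, from s on.
roots : ∀ {n} → ℕ → Vec Tree n → Vec ℕ n
roots s []       = []
roots s (t ∷ ts) = s ∷ roots (s + size t) ts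

describe  : ℕ → Tree → List (Atom σ)
describes : ∀ {n} → ℕ → Vec Tree n → List (Atom σ)
describe s (con k ts) = s ≔ k ⟨ roots (suc s) ts ⟩ ∷ describes (suc s) ts
describes s []        = []
describes s (t ∷ ts)  = describe s t List.++ describes (s + size t) ts

-- The program sits at variable 3, so that its subterms can occupy all variables from 3 on; 1 and 2
-- are the argument and the value.
programView : PR 1 → View σ
programView p = viewAt zero (3 ∷ 1 ∷ 2 ∷ []) (describe 3 (progᵗ p))

-- Variable 4 is both the expected result 0 of the call and the start of the numeral.
chain : ℕ → List (Atom σ)
chain zero    = 4 ≔ Zero ⟨ [] ⟩ ∷ []
chain (suc n) = 5 + n ≔ Succ ⟨ 4 + n ∷ [] ⟩ ∷ chain n

numeralView : ℕ → View σ
numeralView n = viewAt zero (1 ∷ 2 ∷ 4 ∷ [])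
  (2 ≔ Cons ⟨ 4 + n ∷ 3 ∷ [] ⟩ ∷ 3 ≔ Nil ⟨ [] ⟩ ∷ chain n)

evalInstance : PR 1 → ℕ → Instance σ
evalInstance =
  instanceOf numeralView programView (ruleViews implications) (sentenceFor implications)

-- Computing the code of the numeral view

chainP : PR 1
-- Symbol numbers 1 and 2 belong to `Zero` and `Succ`, one above their constructor numbers, since 0
-- is the call relation.
chainP = prec (consP (relP 1 (constP 4 ∷ [])) Z)
  -- `P 0F` is the counter `n` and `P 1F` the code of `chain n`.
  (consP (relP 2 (plusP 5 (P 0F) ∷ plusP 4 (P 0F) ∷ [])) (P 1F))

chainP-eval : ∀ n → Eval chainP (n ∷ []) (atomsCode σ (chain n))
chainP-eval zero    = evRec0
  (atomsP-eval σ (4 ≔ Zero ⟨ [] ⟩) []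
    (relP-eval σ 1F (4 ∷ []) (constP-eval 4 ∷ [])) (atomsP-eval-[] σ))
chainP-eval (suc n) = evRecS (chainP-eval n)
  (atomsP-eval σ (5 + n ≔ Succ ⟨ 4 + n ∷ [] ⟩) (chain n)
    (relP-eval σ 2F (5 + n ∷ 4 + n ∷ []) (plusP-eval 5 evP ∷ plusP-eval 4 evP ∷ []))
    evP)

numeralP : PR 1
numeralP =
  consP (relP 0 (constP 0 ∷ constP 1 ∷ constP 2 ∷ constP 4 ∷ []))
  (consP (relP 4 (constP 2 ∷ plusP 4 (P 0F) ∷ constP 3 ∷ []))
  (consP (relP 3 (constP 3 ∷ [])) chainP))

numeralP-eval : ∀ n → Eval numeralP (n ∷ []) (codeView σ (numeralView n))
numeralP-eval n = subst (Eval numeralP (n ∷ [])) (atomsCode-body σ (numeralView n))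
  (atomsP-eval σ (call 0 1 2 4) _
    (relP-eval σ 0F _ (constP-eval 0 ∷ constP-eval 1 ∷ constP-eval 2 ∷ constP-eval 4 ∷ []))
  (atomsP-eval σ (2 ≔ Cons ⟨ 4 + n ∷ 3 ∷ [] ⟩) _
    (relP-eval σ 4F _ (constP-eval 2 ∷ plusP-eval 4 evP ∷ constP-eval 3 ∷ []))
  (atomsP-eval σ (3 ≔ Nil ⟨ [] ⟩) _ (relP-eval σ 3F _ (constP-eval 3 ∷ []))
  (chainP-eval n))))

-- Sentences in structures

module _ (M : Structure σ) where
  open Structure M

  env : List Carrier → ℕ → Carrier
  env []       _       = elem
  env (x ∷ xs) zero    = x
  env (x ∷ xs) (suc m) = env xs m

  Obeys : View σ × View σ → Set
  Obeys (V , W) = ∀ x → ViewHolds σ M V x → ¬ ¬ ViewHolds σ M W x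

  module _ {m} (𝒱 : Vec (View σ) m) where

    conj⁺ : ∀ {n φ} (ψ : Fin n → Formula σ m 0) → Holds σ M 𝒱 φ (λ ()) →
      (∀ i → Holds σ M 𝒱 (ψ i) (λ ())) → Holds σ M 𝒱 (conj φ ψ) (λ ())
    conj⁺ {zero}  ψ h hs = h
    conj⁺ {suc n} ψ h hs = hs zero , conj⁺ (ψ ∘ suc) h (hs ∘ suc)

    conj⁻ : ∀ {n φ} (ψ : Fin n → Formula σ m 0) → Holds σ M 𝒱 (conj φ ψ) (λ ()) →
      Holds σ M 𝒱 φ (λ ()) × (∀ i → Holds σ M 𝒱 (ψ i) (λ ()))
    conj⁻ {zero}  ψ h        = h , λ ()
    conj⁻ {suc n} ψ (h , hs) = proj₁ (conj⁻ (ψ ∘ suc) hs) , λ where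
      zero    → h
      (suc i) → proj₂ (conj⁻ (ψ ∘ suc) hs) i

  module _ (V W : View σ) (L : List (View σ × View σ)) where

    private
      n : ℕ
      n = List.length L
      𝒱 : Vec (View σ) (suc (suc (n + n)))
      𝒱 = V ∷ W ∷ ruleViews L

    lookup-fromList : ∀ {A : Set} (xs : List A) i → lookup (fromList xs) i ≡ List.lookup xs i
    lookup-fromList (x ∷ xs) zero    = refl
    lookup-fromList (x ∷ xs) (suc i) = lookup-fromList xs i

    lookup-premise : ∀ i → lookup (ruleViews L) (i ↑ˡ n) ≡ proj₁ (List.lookup L i)
    lookup-premise i = trans (lookup-++ˡ (map proj₁ (fromList L)) _ i)
      (trans (lookup-map i proj₁ (fromList L)) (cong proj₁ (lookup-fromList L i)))

    lookup-conclusion : ∀ i → lookup (ruleViews L) (n ↑ʳ i) ≡ proj₂ (List.lookup L i)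
    lookup-conclusion i = trans (lookup-++ʳ (map proj₁ (fromList L)) _ i)
      (trans (lookup-map i proj₂ (fromList L)) (cong proj₂ (lookup-fromList L i)))

    sentence⁺ : ∀ {x} → ViewHolds σ M V x → ViewHolds σ M W x → All Obeys L →
      Holds σ M 𝒱 (sentenceFor L) (λ ())
    sentence⁺ {x} v w obeys = conj⁺ 𝒱 {φ = start} (obeysRule n) (x , v , w) λ i (y , hV , hW) →
      All.lookup obeys (∈-lookup i) y
        (subst (λ U → ViewHolds σ M U y) (lookup-premise i) hV)
        (hW ∘ subst (λ U → ViewHolds σ M U y) (sym (lookup-conclusion i)))

    sentence⁻ : Holds σ M 𝒱 (sentenceFor L) (λ ()) →
      (Σ Carrier λ x → ViewHolds σ M V x × ViewHolds σ M W x) × (∀ {r} → r ∈ L → Obeys r)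
    sentence⁻ h = proj₁ (conj⁻ 𝒱 {φ = start} (obeysRule n) h) ,
      λ {r} r∈L → obeys r (Any.index r∈L) (lookup-index r∈L)
      where
      obeys : ∀ r i → r ≡ List.lookup L i → Obeys r
      obeys r i refl x hV hW = proj₂ (conj⁻ 𝒱 {φ = start} (obeysRule n) h) i
        ( x
        , subst (λ U → ViewHolds σ M U x) (sym (lookup-premise i)) hV
        , hW ∘ subst (λ U → ViewHolds σ M U x) (lookup-conclusion i))

-- `d` fills the variables beyond both tuples.
evens-odds : ∀ {A : Set} {n} → A → Vec A n → Vec A n → ℕ → A
evens-odds d []       []       _             = d
evens-odds d (x ∷ xs) (y ∷ ys) zero          = x
evens-odds d (x ∷ xs) (y ∷ ys) (suc zero)    = y
evens-odds d (x ∷ xs) (y ∷ ys) (suc (suc m)) = evens-odds d xs ys m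

map-evens : ∀ {A : Set} {n} (d : A) (xs ys : Vec A n) → map (evens-odds d xs ys) (evens n) ≡ xs
map-evens d []       []       = refl
map-evens d (x ∷ xs) (y ∷ ys) =
  cong (x ∷_) (trans (sym (map-∘ _ _ (evens _))) (map-evens d xs ys))

map-odds : ∀ {A : Set} {n} (d : A) (xs ys : Vec A n) → map (evens-odds d xs ys) (odds n) ≡ ys
map-odds d []       []       = refl
map-odds d (x ∷ xs) (y ∷ ys) =
  cong (y ∷_) (trans (sym (map-∘ _ _ (odds _))) (map-odds d xs ys))

-- The term model

-- A terminating computation of c on a with result v is witnessed by the term (c , a , v).
relᵗ : (R : Fin 14) → Vec Tree (suc (ar R)) → Set
relᵗ zero    (e ∷ c ∷ a ∷ v ∷ []) = e ≡ consᵗ c (consᵗ a v) × c · a ⇓ v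
relᵗ (suc k) (t ∷ ts)             = t ≡ con k ts

𝕋 : Structure σ
𝕋 = record { Carrier = Tree ; elem = nilᵗ ; relI = relᵗ }

-- Inversion: the constructors exposed by the premises leave one evaluation rule that can end the
-- derivation, and its subderivations justify the new calls. The list `ts` gives the values of the
-- variables from 4 on.
𝕋-conclusions : ∀ r (ρ : ℕ → Tree) → ρ 1 · ρ 2 ⇓ ρ 3 → All (AtomHolds σ 𝕋 ρ) (premises r) →
  Σ (List Tree) λ ts → All (AtomHolds σ 𝕋 (env 𝕋 (ρ 0 ∷ ρ 1 ∷ ρ 2 ∷ ρ 3 ∷ ts))) (conclusions r)
𝕋-conclusions null ρ d (p ∷ []) with ρ 1 | ρ 3 | p | d
... | _ | _ | refl | null = [] , refl ∷ []
𝕋-conclusions incr ρ d (p ∷ []) with ρ 1 | ρ 2 | ρ 3 | p | d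
... | _ | _ | _ | refl | incr = _ ∷ _ ∷ [] , refl ∷ refl ∷ []
𝕋-conclusions head ρ d (p ∷ []) with ρ 1 | ρ 2 | ρ 3 | p | d
... | _ | _ | _ | refl | head = _ ∷ [] , refl ∷ []
𝕋-conclusions skip ρ d (p ∷ []) with ρ 1 | ρ 2 | p | d
... | _ | _ | refl | skip d = _ ∷ _ ∷ _ ∷ _ ∷ [] , refl ∷ refl ∷ (refl , d) ∷ []
𝕋-conclusions comp ρ d (p ∷ []) with ρ 1 | p | d
... | _ | refl | comp ds d =
  _ ∷ _ ∷ _ ∷ _ ∷ _ ∷ [] , refl ∷ (refl , ds) ∷ (refl , d) ∷ []
𝕋-conclusions nil ρ d (p ∷ []) with ρ 1 | ρ 3 | p | d
... | _ | _ | refl | nil = [] , refl ∷ []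
𝕋-conclusions cons ρ d (p ∷ []) with ρ 1 | ρ 3 | p | d
... | _ | _ | refl | cons d ds =
  _ ∷ _ ∷ _ ∷ _ ∷ _ ∷ _ ∷ [] , refl ∷ refl ∷ (refl , d) ∷ (refl , ds) ∷ []
𝕋-conclusions prec₀ ρ d (p ∷ q ∷ z ∷ []) with ρ 1 | ρ 2 | ρ 6 | p | q | z | d
... | _ | _ | _ | refl | refl | refl | prec₀ d =
  _ ∷ _ ∷ _ ∷ _ ∷ _ ∷ [] , refl ∷ refl ∷ (refl , d) ∷ []
𝕋-conclusions precₛ ρ d (p ∷ q ∷ z ∷ []) with ρ 1 | ρ 2 | ρ 6 | p | q | z | d
... | _ | _ | _ | refl | refl | refl | precₛ d e =
  _ ∷ _ ∷ _ ∷ _ ∷ _ ∷ _ ∷ _ ∷ _ ∷ _ ∷ _ ∷ _ ∷ [] ,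
  refl ∷ refl ∷ refl ∷ refl ∷ (refl , d) ∷ refl ∷ refl ∷ (refl , e) ∷ []
𝕋-conclusions mu ρ d (p ∷ []) with ρ 1 | p | d
... | _ | refl | mu d =
  _ ∷ _ ∷ _ ∷ _ ∷ _ ∷ [] , refl ∷ refl ∷ refl ∷ refl ∷ (refl , d) ∷ []
𝕋-conclusions loop ρ d (p ∷ []) with ρ 1 | p | d
... | _ | refl | loop d e =
  _ ∷ _ ∷ _ ∷ _ ∷ _ ∷ _ ∷ [] , refl ∷ (refl , d) ∷ refl ∷ refl ∷ (refl , e) ∷ []
𝕋-conclusions test₀ ρ d (p ∷ q ∷ z ∷ []) with ρ 1 | ρ 2 | ρ 3 | ρ 5 | ρ 6 | p | q | z | d
... | _ | _ | _ | _ | _ | refl | refl | refl | test₀ = _ ∷ _ ∷ _ ∷ [] , refl ∷ refl ∷ []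
𝕋-conclusions testₛ ρ d (p ∷ q ∷ z ∷ []) with ρ 1 | ρ 2 | ρ 5 | ρ 6 | p | q | z | d
... | _ | _ | _ | _ | refl | refl | refl | testₛ d =
  _ ∷ _ ∷ _ ∷ _ ∷ _ ∷ _ ∷ _ ∷ _ ∷ _ ∷ [] ,
  refl ∷ refl ∷ refl ∷ refl ∷ refl ∷ refl ∷ (refl , d) ∷ []

𝕋-rule : ∀ r → Obeys 𝕋 (ruleImplication r)
𝕋-rule r _ (ρ , refl , (e≡ , d) ∷ prem) no with 𝕋-conclusions r ρ d prem
... | ts , concl = no (env 𝕋 (ρ 0 ∷ ρ 1 ∷ ρ 2 ∷ ρ 3 ∷ ts) , refl , (e≡ , d) ∷ concl)

-- A call witness stores its program, argument and value; the other symbols are graphs of injective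
-- constructors.
relᵗ-functional : ∀ R t {us ws} → relᵗ R (t ∷ us) → relᵗ R (t ∷ ws) → us ≡ ws
relᵗ-functional zero    _ {_ ∷ _ ∷ _ ∷ []} {_ ∷ _ ∷ _ ∷ []} (refl , _) (refl , _) = refl
relᵗ-functional (suc k) _ refl refl = refl

𝕋-FD : ∀ R i → Obeys 𝕋 (FDView R i , falseView)
𝕋-FD R i _ (ρ , _ , p ∷ q ∷ ne ∷ []) _ = ne (trans (sym (lookup-map i ρ (FDVars evens R)))
  (trans (cong (λ us → lookup us i) (relᵗ-functional R (ρ 0) p q))
    (lookup-map i ρ (FDVars odds R))))

𝕋-obeys : All (Obeys 𝕋) implications
𝕋-obeys = (λ { _ (ρ , _ , p ∷ q ∷ []) _ → zero≢suc (trans (sym p) q) }) ∷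
  ++⁺ (map⁺ {f = ruleImplication} (All.universal 𝕋-rule allRules))
      (concat⁺ (map⁺ {f = FDImplications} (All.universal 𝕋-FDs (allFin 14))))
  where
  𝕋-FDs : ∀ R → All (Obeys 𝕋) (FDImplications R)
  𝕋-FDs R = map⁺ {f = λ i → FDView R i , falseView} (All.universal (𝕋-FD R) (allFin (ar R)))
  zero≢suc : ∀ {t} → ¬ zeroᵗ ≡ sucᵗ t
  zero≢suc ()

-- Enumerates the subterms in the numbering used by `describe`, then continues with `r`.
preorder  : Tree → (ℕ → Tree) → ℕ → Tree
preorders : ∀ {n} → Vec Tree n → (ℕ → Tree) → ℕ → Tree
preorder (con k ts) r zero    = con k ts
preorder (con k ts) r (suc m) = preorders ts r m
preorders []       r = r
preorders (t ∷ ts) r = preorder t (preorders ts r)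

preorder-+  : ∀ t r m → preorder t r (size t + m) ≡ r m
preorders-+ : ∀ {n} (ts : Vec Tree n) r m → preorders ts r (sizes ts + m) ≡ r m
preorder-+ (con k ts) r m = preorders-+ ts r m
preorders-+ []       r m = refl
preorders-+ (t ∷ ts) r m rewrite +-assoc (size t) (sizes ts) m =
  trans (preorder-+ t _ (sizes ts + m)) (preorders-+ ts r m)

-- The value at `s` and the atoms are proved together because the atom of a node mentions the roots
-- of its children.
𝕋-describe : ∀ t {r ρ s} → (∀ m → ρ (s + m) ≡ preorder t r m) →
  ρ s ≡ t × All (AtomHolds σ 𝕋 ρ) (describe s t)
𝕋-describes : ∀ {n} (ts : Vec Tree n) {r ρ s} → (∀ m → ρ (s + m) ≡ preorders ts r m) →
  map ρ (roots s ts) ≡ ts × All (AtomHolds σ 𝕋 ρ) (describes s ts)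
𝕋-describe (con k ts) {ρ = ρ} {s} eq
  with 𝕋-describes ts {s = suc s} (λ m → trans (cong ρ (sym (+-suc s m))) (eq (suc m)))
... | ts≡ , atoms = t≡ , trans t≡ (cong (con k) (sym ts≡)) ∷ atoms
  where
  t≡ : ρ s ≡ con k ts
  t≡ = trans (cong ρ (sym (+-identityʳ s))) (eq 0)
𝕋-describes []       eq = refl , []
𝕋-describes (t ∷ ts) {ρ = ρ} {s} eq with 𝕋-describe t eq | 𝕋-describes ts {s = s + size t}
    (λ m → trans (cong ρ (+-assoc s (size t) m)) (trans (eq (size t + m)) (preorder-+ t _ m)))
... | t≡ , atoms | ts≡ , atoms′ = cong₂ _∷_ t≡ ts≡ , ++⁺ atoms atoms′

𝕋-chain : ∀ n {ρ} → (∀ i → ρ (4 + i) ≡ numᵗ i) → All (AtomHolds σ 𝕋 ρ) (chain n)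
𝕋-chain zero    eq = eq 0 ∷ []
𝕋-chain (suc n) eq = trans (eq (suc n)) (cong (λ t → sucᵗ t) (sym (eq n))) ∷ 𝕋-chain n eq

accepting : ∀ p n → Eval p (n ∷ []) 0 → Satisfiable σ (evalInstance p n)
accepting p n d = 𝕋 , sentence⁺ 𝕋 (numeralView n) (programView p) implications {x = e}
  (ρ , refl , (refl , D) ∷ refl ∷ refl ∷ 𝕋-chain n (λ _ → refl))
  (ρ′ , refl , describeP)
  𝕋-obeys
  where
  c a e : Tree
  c = progᵗ p
  a = numsᵗ (n ∷ [])
  e = consᵗ c (consᵗ a zeroᵗ)
  D : c · a ⇓ zeroᵗ
  D = Eval⇒⇓ d
  ρ ρ′ : ℕ → Tree
  ρ 0 = e
  ρ 1 = c
  ρ 2 = a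
  ρ 3 = nilᵗ
  ρ (suc (suc (suc (suc i)))) = numᵗ i
  -- The two assignments have to agree only at variable 0; here the program comes last, from
  -- variable 3 on.
  ρ′ 0 = e
  ρ′ 1 = a
  ρ′ 2 = zeroᵗ
  ρ′ (suc (suc (suc m))) = preorder c (λ _ → nilᵗ) m
  describeP : All (AtomHolds σ 𝕋 ρ′) (View.body (programView p))
  describeP with 𝕋-describe c {ρ = ρ′} {s = 3} (λ _ → refl)
  ... | c≡ , atoms =
    ( cong (λ c → consᵗ c (consᵗ a zeroᵗ)) (sym c≡)
    , subst (λ c → c · a ⇓ zeroᵗ) (sym c≡) D) ∷ atoms

-- Arbitrary models

infixl 1 _>>=_

_>>=_ : ∀ {A B : Set} → ¬ ¬ A → (A → ¬ ¬ B) → ¬ ¬ B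
(m >>= k) no = m (λ x → k x no)

∈-allRules : ∀ r → r ∈ allRules
∈-allRules null  = ∈-lookup 0F
∈-allRules incr  = ∈-lookup 1F
∈-allRules head  = ∈-lookup 2F
∈-allRules skip  = ∈-lookup 3F
∈-allRules comp  = ∈-lookup 4F
∈-allRules nil   = ∈-lookup 5F
∈-allRules cons  = ∈-lookup 6F
∈-allRules prec₀ = ∈-lookup 7F
∈-allRules precₛ = ∈-lookup 8F
∈-allRules mu    = ∈-lookup 9F
∈-allRules loop  = ∈-lookup (suc 9F)
∈-allRules test₀ = ∈-lookup (suc (suc 9F))
∈-allRules testₛ = ∈-lookup (suc (suc (suc 9F)))

∈-rule : ∀ r → ruleImplication r ∈ implications
∈-rule r = there (∈-++⁺ˡ (∈-map⁺ ruleImplication (∈-allRules r)))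

∈-FD : ∀ R i → (FDView R i , falseView) ∈ implications
∈-FD R i = there (∈-++⁺ʳ (List.map ruleImplication allRules)
  (∈-concatMap⁺ FDImplications (Any.map (λ { refl →
    ∈-map⁺ (λ i → FDView R i , falseView) (∈-allFin i) }) (∈-allFin R))))

-- Double negation commutes with a conjunction of finitely many equations.
lookup≡⇒≡ : ∀ {A : Set} {n} (xs ys : Vec A n) → (∀ i → ¬ ¬ lookup xs i ≡ lookup ys i) → ¬ ¬ xs ≡ ys
lookup≡⇒≡ []       []       eq no = no refl
lookup≡⇒≡ (x ∷ xs) (y ∷ ys) eq = do
  refl ← eq zero
  refl ← lookup≡⇒≡ xs ys (eq ∘ suc)
  λ no → no refl

module _ (M : Structure σ) (obeys : ∀ {r} → r ∈ implications → Obeys M r) where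
  open Structure M

  falseView-empty : ∀ x → ¬ ViewHolds σ M falseView x
  falseView-empty x (ρ , _ , _ ∷ ne ∷ []) = ne refl

  zero-suc-clash : ∀ {x y} → relI 1F (x ∷ []) → relI 2F (x ∷ y ∷ []) → ⊥
  zero-suc-clash {x} {y} z s = obeys (here refl) x
    (env M (x ∷ y ∷ []) , refl , z ∷ s ∷ []) (falseView-empty x)

  -- If the entries at `i` differed, placing `us` and `ws` on the interleaved variables would put
  -- `x` in `FDView R i`, which must be empty.
  functional : ∀ R {x us ws} → relI R (x ∷ us) → relI R (x ∷ ws) → ¬ ¬ us ≡ ws
  functional R {x} {us} {ws} p q = lookup≡⇒≡ us ws λ i ne → obeys (∈-FD R i) x
    ( ρ , refl
    , subst (λ us → relI R (x ∷ us)) (sym evens≡) p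
    ∷ subst (λ ws → relI R (x ∷ ws)) (sym odds≡) q
    ∷ (λ eq → ne (trans (at evens us evens≡ i) (trans eq (sym (at odds ws odds≡ i)))))
    ∷ [] )
    (falseView-empty x)
    where
    ρ : ℕ → Carrier
    ρ zero    = x
    ρ (suc m) = evens-odds x us ws m
    evens≡ : map ρ (FDVars evens R) ≡ us
    evens≡ = trans (sym (map-∘ ρ suc (evens (ar R)))) (map-evens x us ws)
    odds≡ : map ρ (FDVars odds R) ≡ ws
    odds≡ = trans (sym (map-∘ ρ suc (odds (ar R)))) (map-odds x us ws)
    at : ∀ f xs → map ρ (FDVars f R) ≡ xs → ∀ i → lookup xs i ≡ ρ (lookup (FDVars f R) i)
    at f xs eq i = trans (cong (λ xs → lookup xs i) (sym eq)) (lookup-map i ρ (FDVars f R))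

  infix 4 _⊩_ _⊩*_

  -- A relation and not a map: an element of an arbitrary model may represent several terms or none.
  _⊩_  : Carrier → Tree → Set
  _⊩*_ : ∀ {n} → Vec Carrier n → Vec Tree n → Set
  x ⊩ con k ts        = Σ (Vec Carrier (ar (suc k))) λ xs → relI (suc k) (x ∷ xs) × xs ⊩* ts
  [] ⊩* []             = ⊤
  (x ∷ xs) ⊩* (t ∷ ts) = x ⊩ t × xs ⊩* ts

  -- The functional dependency identifies the children in the given atom with those witnessing the
  -- representation.
  children : ∀ k {x xs ts} → x ⊩ con k ts → relI (suc k) (x ∷ xs) → ¬ ¬ xs ⊩* ts
  children k {ts = ts} (ys , q , h) p = do
    eq ← functional (suc k) q p
    λ no → no (subst (_⊩* ts) eq h)

  Call : Carrier → Carrier → Carrier → Carrier → Set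
  Call e c a v = relI zero (e ∷ c ∷ a ∷ v ∷ [])

  -- The conclusion view returns an assignment known to agree only at `e`. The functional dependency
  -- of calls identifies its variables 1, 2, 3 with `c`, `a`, `v`, so representations pass to `ρ`
  -- and the one obtained for `ρ 3` passes back.
  step : ∀ r {e c a v C A V} → Call e c a v → c ⊩ C → a ⊩ A → ∀ ws →
    All (AtomHolds σ M (env M (e ∷ c ∷ a ∷ v ∷ ws))) (premises r) →
    (∀ ρ → ρ 1 ⊩ C → ρ 2 ⊩ A → All (AtomHolds σ M ρ) (conclusions r) → ¬ ¬ ρ 3 ⊩ V) →
    ¬ ¬ v ⊩ V
  step r {e} {c} {a} {v} {C} {A} {V} p hc ha ws prem κ = do
    ρ , eq₀ , q ∷ concl ← obeys (∈-rule r) e (env M (e ∷ c ∷ a ∷ v ∷ ws) , refl , p ∷ prem)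
    eq ← functional zero p (subst (λ e → Call e (ρ 1) (ρ 2) (ρ 3)) eq₀ q)
    let at = λ i → cong (λ xs → lookup xs i) eq
    h ← κ ρ (subst (_⊩ C) (at 0F) hc) (subst (_⊩ A) (at 1F) ha) concl
    λ no → no (subst (_⊩ V) (sym (at 2F)) h)

  -- Induction on the derivation: the conclusions of the matching rule supply a call for every
  -- subderivation, with program and argument assembled from parts already represented.
  sound : ∀ {C A V} → C · A ⇓ V → ∀ {e c a v} → Call e c a v → c ⊩ C → a ⊩ A → ¬ ¬ v ⊩ V
  sound null p hc@([] , r , _) ha =
    step null p hc ha [] (r ∷ []) λ { ρ _ _ (z ∷ []) no → no ([] , z , tt) }
  sound incr p hc@([] , r , _) ha =
    step incr p hc ha [] (r ∷ []) λ { ρ _ ha (s ∷ t ∷ []) → do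
      hx , _ ← children Cons ha s
      λ no → no (_ , t , hx , tt) }
  sound head p hc@([] , r , _) ha =
    step head p hc ha [] (r ∷ []) λ { ρ _ ha (s ∷ []) → do
      hx , _ ← children Cons ha s
      λ no → no hx }
  sound (skip d) p hc@(c ∷ [] , r , _) ha =
    step skip p hc ha (c ∷ []) (r ∷ []) λ { ρ hc ha (r ∷ s ∷ q ∷ []) → do
      hc , _ ← children Skip hc r
      _ , ha , _ ← children Cons ha s
      sound d q hc ha }
  sound (comp ds d) p hc@(f ∷ gs ∷ [] , r , _) ha =
    step comp p hc ha (f ∷ gs ∷ []) (r ∷ []) λ { ρ hc ha (r ∷ q₁ ∷ q₂ ∷ []) → do
      hf , hgs , _ ← children Comp hc r
      hb ← sound ds q₁ hgs ha
      sound d q₂ hf hb }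
  sound nil p hc@([] , r , _) ha =
    step nil p hc ha [] (r ∷ []) λ { ρ _ _ (z ∷ []) no → no ([] , z , tt) }
  sound (cons d ds) p hc@(g ∷ gs ∷ [] , r , _) ha =
    step cons p hc ha (g ∷ gs ∷ []) (r ∷ []) λ { ρ hc ha (r ∷ s ∷ q₁ ∷ q₂ ∷ []) → do
      hg , hgs , _ ← children Cons hc r
      hv ← sound d q₁ hg ha
      hb ← sound ds q₂ hgs ha
      λ no → no (_ , s , hv , hb , tt) }
  -- Matching on `ha` as well exposes the constructor of the first argument, which selects the rule.
  sound (prec₀ d) p hc@(g ∷ h ∷ [] , r , _) ha@(x ∷ b ∷ [] , s , ([] , z , _) , _) =
    step prec₀ p hc ha (g ∷ h ∷ x ∷ b ∷ []) (r ∷ s ∷ z ∷ []) λ { ρ hc ha (r ∷ s ∷ q ∷ []) → do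
      hg , _ ← children Prec hc r
      _ , hb , _ ← children Cons ha s
      sound d q hg hb }
  sound (precₛ d₁ d₂) p hc@(g ∷ h ∷ [] , r , _) ha@(x ∷ b ∷ [] , s , (y ∷ [] , z , _) , _) =
    step precₛ p hc ha (g ∷ h ∷ x ∷ b ∷ y ∷ []) (r ∷ s ∷ z ∷ [])
      λ { ρ hc ha (r ∷ s ∷ z ∷ s₁ ∷ q₁ ∷ s₂ ∷ s₃ ∷ q₂ ∷ []) → do
      _ , hh , _ ← children Prec hc r
      hx , hb , _ ← children Cons ha s
      hy , _ ← children Succ hx z
      -- The intermediate result must be known first, being part of the argument of the second call.
      hr ← sound d₁ q₁ hc (_ , s₁ , hy , hb , tt)
      sound d₂ q₂ hh (_ , s₃ , hy , (_ , s₂ , hr , hb , tt) , tt) }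
  sound (mu d) p hc@(f ∷ [] , r , _) ha =
    step mu p hc ha (f ∷ []) (r ∷ []) λ { ρ hc ha (r ∷ z ∷ s ∷ l ∷ q ∷ []) → do
      hf , _ ← children Mu hc r
      sound d q (_ , l , hf , tt) (_ , s , ([] , z , tt) , ha , tt) }
  sound (loop d₁ d₂) p hc@(f ∷ [] , r , _) ha =
    step loop p hc ha (f ∷ []) (r ∷ []) λ { ρ hc ha (r ∷ q₁ ∷ s ∷ t ∷ q₂ ∷ []) → do
      hf , _ ← children Loop hc r
      hw ← sound d₁ q₁ hf ha
      sound d₂ q₂ (_ , t , hf , tt) (_ , s , hw , ha , tt) }
  sound test₀ p hc@(f ∷ [] , r , _) ha@(w ∷ b ∷ [] , s , ([] , z , _) , _) =
    step test₀ p hc ha (f ∷ w ∷ b ∷ []) (r ∷ s ∷ z ∷ []) λ { ρ _ ha (s₁ ∷ s₂ ∷ []) → do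
      _ , hb , _ ← children Cons ha s₁
      hx , _ ← children Cons hb s₂
      λ no → no hx }
  sound (testₛ d) p hc@(f ∷ [] , r , _) ha@(w ∷ b ∷ [] , s , (y ∷ [] , z , _) , _) =
    step testₛ p hc ha (f ∷ w ∷ b ∷ y ∷ []) (r ∷ s ∷ z ∷ [])
      λ { ρ hc ha (r ∷ s₁ ∷ s₂ ∷ u ∷ s₃ ∷ l ∷ q ∷ []) → do
      hf , _ ← children Test hc r
      _ , hb , _ ← children Cons ha s₁
      hx , ha , _ ← children Cons hb s₂
      sound d q (_ , l , hf , tt) (_ , s₃ , (_ , u , hx , tt) , ha , tt) }

  describe-⊩ : ∀ t {ρ s} → All (AtomHolds σ M ρ) (describe s t) → ρ s ⊩ t
  describes-⊩ : ∀ {n} (ts : Vec Tree n) {ρ s} → All (AtomHolds σ M ρ) (describes s ts) →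
    map ρ (roots s ts) ⊩* ts
  describe-⊩ (con k ts) (p ∷ ps) = _ , p , describes-⊩ ts ps
  describes-⊩ []       ps = tt
  describes-⊩ (t ∷ ts) {s = s} ps =
    describe-⊩ t (++⁻ˡ (describe s t) ps) , describes-⊩ ts (++⁻ʳ (describe s t) ps)

  chain-⊩ : ∀ n {ρ} → All (AtomHolds σ M ρ) (chain n) → ρ (4 + n) ⊩ numᵗ n
  chain-⊩ zero    (z ∷ [])  = [] , z , tt
  chain-⊩ (suc n) (s ∷ ps) = _ , s , chain-⊩ n ps , tt

  chain-zero : ∀ n {ρ} → All (AtomHolds σ M ρ) (chain n) → relI 1F (ρ 4 ∷ [])
  chain-zero zero    (z ∷ [])  = z
  chain-zero (suc n) (_ ∷ ps) = chain-zero n ps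

  -- The shared witness merges the two calls, so variable 4 represents 1 by `sound`, while the chain
  -- makes it zero.
  result≢1 : ∀ p n {x} → Eval p (n ∷ []) 1 →
    ViewHolds σ M (numeralView n) x → ViewHolds σ M (programView p) x → ⊥
  result≢1 p n d (ρ , refl , q ∷ s ∷ z ∷ ps) (ρ′ , eq₀ , q′ ∷ ps′) = result λ ()
    where
    result : ¬ ¬ ⊥
    result = do
      eq ← functional zero q (subst (λ e → Call e (ρ′ 3) (ρ′ 1) (ρ′ 2)) eq₀ q′)
      hv ← sound (Eval⇒⇓ d) q
        (subst (_⊩ progᵗ p) (cong (λ xs → lookup xs 0F) (sym eq)) (describe-⊩ (progᵗ p) ps′))
        (_ , s , chain-⊩ n ps , ([] , z , tt) , tt)
      λ _ → one≢zero hv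
      where
      one≢zero : ρ 4 ⊩ numᵗ 1 → ⊥
      one≢zero (_ ∷ [] , t , _) = zero-suc-clash (chain-zero n ps) t

rejecting : ∀ p n → Eval p (n ∷ []) 1 → ¬ Satisfiable σ (evalInstance p n)
rejecting p n d (M , h) with sentence⁻ M (numeralView n) (programView p) implications h
... | (x , hn , hp) , obeys = result≢1 M obeys p n d hn hp

theorem5p1 : Σ Vocab λ σ → ¬ (Σ (PR 1) λ f → DecidesSat σ f)
theorem5p1 = σ ,
  undecidable numeralView programView (ruleViews implications) (sentenceFor implications)
    numeralP numeralP-eval accepting rejecting
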